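{- There exists an instance of Completion-Times in which no solution is better than a simultaneous $1.13$-approximation for the $L_1$ and $L_\infty$ norms; that is, for every solution with completion-time vector $v$, there is $p\in\{1,\infty\}$ such that $\|v\|_p\ge 1.13\cdot\min_{v'}\|v'\|_p$, where the minimum is over completion-time vectors $v'$ of all solutions.
   Context: Completion-Times: given $n$ jobs, $d$ machines and processing times $p_{i,j}>0$ of job $j$ on machine $i$, a solution is an assignment of each job to a machine and an order on the jobs assigned to each machine; the completion time of job $j$ assigned to machine $i$ is the sum of $p_{i,j'}$ over jobs $j'$ assigned to $i$ up to and including $j$ in the order on $i$. The completion-time vector in $\mathbb{R}^n$ collects completion times of all jobs. The $L_1$ objective is total (average) completion time and the $L_\infty$ objective is makespan. -}

module Defs where

open import Data.Nat.Base using (ℕ; NonZero)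
open import Data.Fin.Base using (Fin)
open import Data.Fin.Properties using (_≟_)
open import Data.Product.Base using (Σ; ∃; _×_; _,_)
open import Data.Rational using (ℚ; 0ℚ; _≤_; _<_; _⊔_; ∣_∣)
open import Data.Rational.Properties using (+-0-commutativeMonoid)
open import Data.Vec.Functional using (Vector; foldr; map)
open import Level using (0ℓ)
open import Relation.Binary.Core using (Rel)
open import Relation.Binary.Structures using (IsDecTotalOrder)
open import Relation.Binary.PropositionalEquality.Core using (_≡_; refl)
open import Relation.Nullary.Decidable using (Dec; yes; no; does)
open import Data.Bool.Base using (if_then_else_)
open import Algebra.Properties.CommutativeMonoid.Sum +-0-commutativeMonoid using (sum)

-- The nonemptiness conditions rule out the degenerate instances: without jobs
-- both norms are 0, and with jobs but no machines there are no solutions.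
record Instance : Set where
  field
    n d   : ℕ
    .{{n≢0}} : NonZero n
    .{{d≢0}} : NonZero d
    time  : Fin d → Fin n → ℚ
    time>0 : ∀ i j → 0ℚ < time i j

module _ (I : Instance) where
  open Instance I

  record Solution : Set₁ where
    field
      machine : Fin n → Fin d

    JobOn : Fin d → Set
    JobOn i = Σ (Fin n) λ j → machine j ≡ i

    field
      -- A reflexive order: every job is before itself.
      before : (i : Fin d) → Rel (JobOn i) 0ℓ
      -- Decidability is no restriction classically; it lets completion times
      -- be computed.
      isDecTotalOrder : ∀ i → IsDecTotalOrder _≡_ (before i)

    before? : ∀ i (x y : JobOn i) → Dec (before i x y)
    before? i = IsDecTotalOrder._≤?_ (isDecTotalOrder i)

    -- What job j′ adds to the completion time of job j: its processing time if
    -- it runs on the same machine up to and including j, otherwise nothing.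
    contribution : Fin n → Fin n → ℚ
    contribution j j′ with machine j′ ≟ machine j
    ... | yes same = if does (before? (machine j) (j′ , same) (j , refl))
                     then time (machine j) j′ else 0ℚ
    ... | no  _    = 0ℚ

    completionTime : Vector ℚ n
    completionTime j = sum (contribution j)

data Exponent : Set where
  one infinity : Exponent

-- For infinity, starting the maximum at 0ℚ is harmless as absolute values are
-- nonnegative.
norm : Exponent → ∀ {n} → Vector ℚ n → ℚ
norm one      v = sum (map ∣_∣ v)
norm infinity v = foldr _⊔_ 0ℚ (map ∣_∣ v)

IsMinNorm : Instance → Exponent → ℚ → Set₁
IsMinNorm I p m =
  (∃ λ (s : Solution I) → norm p (Solution.completionTime s) ≡ m) ×
  (∀ (s : Solution I) → m ≤ norm p (Solution.completionTime s))

{-# OPTIONS --safe #-}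
-- Take two machines and two jobs, the first with times (1, 3) and the second
-- with times (3, 5) on the two machines.  Sharing the first machine is optimal
-- for L₁ (1 + 4 = 5, makespan 4), whereas moving the first job to the second
-- machine is optimal for L∞ (makespan 3, but 3 + 3 = 6 for L₁).  Every
-- completion-time vector dominates one of (1, 4), (4, 3), (3, 3), (1, 5), and
-- each of these has L₁ norm at least 6/5 or L∞ norm at least 4/3 of the optimum.
module Submission where

open import Defs
open import Axiom.UniquenessOfIdentityProofs.WithK using (uip)
open import Data.Bool.Base using (true; false)
import Data.Fin.Base as Fin using (_≤_)
open import Data.Fin.Base using (Fin; zero; suc; punchOut)
open import Data.Fin.Patterns using (0F; 1F; 2F; 3F)
open import Data.Fin.Properties
  using (_≟_; all?; ≤-isDecTotalOrder)
open import Data.Integer.Base using (+_)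
open import Data.Nat.Base using (zero; suc)
open import Data.Product.Base using (_×_; ∃; _,_; proj₁)
open import Data.Rational
  using (ℚ; _/_; _*_; _≥_; _+_; _≤_; _≤?_; _<?_; 0ℚ; 1ℚ; ∣_∣)
open import Data.Rational.Properties
  using ( ≤-refl; ≤-trans; <⇒≤; +-mono-≤; +-monoʳ-≤; ⊔-mono-≤
        ; +-identityʳ; 0≤p⇒∣p∣≡p; +-0-commutativeMonoid
        ; module ≤-Reasoning)
open import Algebra.Properties.CommutativeMonoid.Sum +-0-commutativeMonoid
  using (sum; sum-remove)
open import Data.Sum.Base using (_⊎_; inj₁; inj₂)
open import Data.Vec.Functional using (Vector; []; _∷_; removeAt)
open import Data.Vec.Functional.Properties using (removeAt-punchOut)
open import Function.Base using (_on_)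
open import Relation.Binary.Structures using (IsDecTotalOrder)
open import Relation.Binary.PropositionalEquality
  using (_≡_; _≢_; refl; cong; cong₂; isEquivalence)
open import Relation.Nullary.Decidable
  using (yes; no; does; dec-true; from-yes; map′; _⊎-dec_)
open import Relation.Nullary.Negation using (contradiction)

sum-nonneg : ∀ {n} (t : Vector ℚ n) → (∀ j → 0ℚ ≤ t j) → 0ℚ ≤ sum t
sum-nonneg {zero}  t 0≤t = ≤-refl
sum-nonneg {suc n} t 0≤t =
  +-mono-≤ (0≤t zero) (sum-nonneg (λ j → t (suc j)) (λ j → 0≤t (suc j)))

term≤sum : ∀ {n} (t : Vector ℚ n) → (∀ j → 0ℚ ≤ t j) → ∀ j → t j ≤ sum t
term≤sum {suc n} t 0≤t j = begin
  t j                        ≡⟨ +-identityʳ (t j) ⟨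
  t j + 0ℚ                   ≤⟨ +-monoʳ-≤ (t j) (sum-nonneg (removeAt t j) (λ _ → 0≤t _)) ⟩
  t j + sum (removeAt t j)   ≡⟨ sum-remove {i = j} t ⟨
  sum t                      ∎
  where open ≤-Reasoning

-- Once position `j` is split off, `k` survives at position `punchOut j≢k` of the remaining vector,
-- so the one-term bound applies there.
two-terms≤sum : ∀ {n} (t : Vector ℚ n) → (∀ j → 0ℚ ≤ t j) →
                ∀ {j k} → j ≢ k → t j + t k ≤ sum t
two-terms≤sum {suc n} t 0≤t {j} {k} j≢k = begin
  t j + t k                             ≡⟨ cong (λ x → t j + x) (removeAt-punchOut t j≢k) ⟨
  t j + removeAt t j (punchOut j≢k)     ≤⟨ +-monoʳ-≤ (t j) (term≤sum (removeAt t j) (λ _ → 0≤t _) (punchOut j≢k)) ⟩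
  t j + sum (removeAt t j)              ≡⟨ sum-remove {i = j} t ⟨
  sum t                                 ∎
  where open ≤-Reasoning

norm-mono : ∀ p {n} (v w : Vector ℚ n) → (∀ j → ∣ v j ∣ ≤ ∣ w j ∣) → norm p v ≤ norm p w
norm-mono one      {zero}  v w v≤w = ≤-refl
norm-mono one      {suc n} v w v≤w =
  +-mono-≤ (v≤w zero) (norm-mono one (λ j → v (suc j)) (λ j → w (suc j)) (λ j → v≤w (suc j)))
norm-mono infinity {zero}  v w v≤w = ≤-refl
norm-mono infinity {suc n} v w v≤w =
  ⊔-mono-≤ (v≤w zero) (norm-mono infinity (λ j → v (suc j)) (λ j → w (suc j)) (λ j → v≤w (suc j)))

∣-∣-mono : ∀ {p q} → 0ℚ ≤ p → p ≤ q → ∣ p ∣ ≤ ∣ q ∣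
∣-∣-mono {p} {q} 0≤p p≤q = begin
  ∣ p ∣ ≡⟨ 0≤p⇒∣p∣≡p 0≤p ⟩
  p     ≤⟨ p≤q ⟩
  q     ≡⟨ 0≤p⇒∣p∣≡p (≤-trans 0≤p p≤q) ⟨
  ∣ q ∣ ∎
  where open ≤-Reasoning

module _ {I : Instance} where
  open Instance I

  module _ (s : Solution I) where
    open Solution s

    contribution-nonneg : ∀ j j′ → 0ℚ ≤ contribution j j′
    contribution-nonneg j j′ with machine j′ ≟ machine j
    ... | no  _    = ≤-refl
    ... | yes same with does (before? (machine j) (j′ , same) (j , refl))
    ...   | true  = <⇒≤ (time>0 (machine j) j′)
    ...   | false = ≤-refl

    contribution-before : ∀ {i j j′} (at′ : machine j′ ≡ i) (at : machine j ≡ i) →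
                          before i (j′ , at′) (j , at) → contribution j j′ ≡ time i j′
    contribution-before {j = j} {j′} at′ refl j′≤j with machine j′ ≟ machine j
    ... | no  different = contradiction at′ different
    ... | yes same
      -- The test inside `contribution` yields its own proof `same`, whereas the hypothesis on the
      -- order speaks of `at′`. Uniqueness of identity proofs makes them the same element of
      -- `JobOn`.
      rewrite uip same at′
            | dec-true (before? (machine j) (j′ , at′) (j , refl)) j′≤j = refl

    contribution-self : ∀ {i j} → machine j ≡ i → contribution j j ≡ time i j
    contribution-self {i} at = contribution-before at at (IsDecTotalOrder.refl (isDecTotalOrder i))

    time≤completionTime : ∀ {i j} → machine j ≡ i → time i j ≤ completionTime j
    time≤completionTime {i} {j} at = begin
      time i j         ≡⟨ contribution-self at ⟨
      contribution j j ≤⟨ term≤sum (contribution j) (contribution-nonneg j) j ⟩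
      completionTime j ∎
      where open ≤-Reasoning

    -- The predecessor and the job itself are two distinct terms of a sum whose other terms are
    -- nonnegative.
    time+time≤completionTime : ∀ {i j j′} (at′ : machine j′ ≡ i) (at : machine j ≡ i) → j′ ≢ j →
                               before i (j′ , at′) (j , at) →
                               time i j′ + time i j ≤ completionTime j
    time+time≤completionTime {i} {j} {j′} at′ at j′≢j j′≤j = begin
      time i j′ + time i j                 ≡⟨ cong₂ _+_ (contribution-before at′ at j′≤j) (contribution-self at) ⟨
      contribution j j′ + contribution j j ≤⟨ two-terms≤sum (contribution j) (contribution-nonneg j) j′≢j ⟩
      completionTime j                     ∎
      where open ≤-Reasoning

  -- Supplies the witnesses that attain the two minima. Ordering by index suffices because job 0 is
  -- the shorter one on the first machine.
  scheduleByIndex : (Fin n → Fin d) → Solution I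
  scheduleByIndex machine = record
    { machine         = machine
    ; before          = λ _ → Fin._≤_ on proj₁
    ; isDecTotalOrder = λ i → record
      { isTotalOrder = record
        { isPartialOrder = record
          { isPreorder = record
            { isEquivalence = isEquivalence
            ; reflexive     = λ { refl → Index.refl }
            ; trans         = Index.trans
            }
          ; antisym = λ x≤y y≤x → JobOn-≡ (Index.antisym x≤y y≤x)
          }
        ; total = λ x y → Index.total (proj₁ x) (proj₁ y)
        }
      ; _≟_  = λ x y → map′ JobOn-≡ (cong proj₁) (proj₁ x ≟ proj₁ y)
      ; _≤?_ = λ x y → proj₁ x Index.≤? proj₁ y
      }
    }
    where
    module Index = IsDecTotalOrder (≤-isDecTotalOrder {n})
    JobOn-≡ : ∀ {i} {x y : ∃ λ j → machine j ≡ i} → proj₁ x ≡ proj₁ y → x ≡ y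
    JobOn-≡ {x = j , at} {.j , at′} refl = cong (j ,_) (uip at at′)

3ℚ 4ℚ 5ℚ : ℚ
3ℚ = + 3 / 1
4ℚ = + 4 / 1
5ℚ = + 5 / 1

processingTime : Fin 2 → Fin 2 → ℚ
processingTime = (1ℚ ∷ 3ℚ ∷ []) ∷ (3ℚ ∷ 5ℚ ∷ []) ∷ []

gapInstance : Instance
gapInstance = record
  { n      = 2
  ; d      = 2
  ; time   = processingTime
  ; time>0 = from-yes (all? λ i → all? λ j → 0ℚ <? processingTime i j)
  }

-- In order: both jobs on machine 0 with job 0 first; the same with job 1 first; job 0 on machine 1
-- and job 1 on machine 0; job 1 on machine 1, wherever job 0 runs.
profile : Fin 4 → Vector ℚ 2
profile = (1ℚ ∷ 4ℚ ∷ []) ∷ (4ℚ ∷ 3ℚ ∷ []) ∷ (3ℚ ∷ 3ℚ ∷ []) ∷ (1ℚ ∷ 5ℚ ∷ []) ∷ []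

opt : Exponent → ℚ
opt one      = 5ℚ
opt infinity = 3ℚ

completionTime≥profile : ∀ (s : Solution gapInstance) →
                         ∃ λ k → ∀ j → profile k j ≤ Solution.completionTime s j
completionTime≥profile s = bound (machine 0F) (machine 1F) refl refl
  where
  open Solution s

  bound : ∀ i i′ → machine 0F ≡ i → machine 1F ≡ i′ →
          ∃ λ k → ∀ j → profile k j ≤ completionTime j
  bound 0F 0F at₀ at₁ with IsDecTotalOrder.total (isDecTotalOrder 0F) (0F , at₀) (1F , at₁)
  ... | inj₁ 0≤1 = 0F , λ { 0F → time≤completionTime s at₀
                          ; 1F → time+time≤completionTime s at₀ at₁ (λ ()) 0≤1 }
  ... | inj₂ 1≤0 = 1F , λ { 0F → time+time≤completionTime s at₁ at₀ (λ ()) 1≤0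
                          ; 1F → time≤completionTime s at₁ }
  bound 1F 0F at₀ at₁ = 2F , λ { 0F → time≤completionTime s at₀
                               ; 1F → time≤completionTime s at₁ }
  bound 0F 1F at₀ at₁ = 3F , λ { 0F → time≤completionTime s at₀
                               ; 1F → time≤completionTime s at₁ }
  -- The processing times 3 and 5 alone already dominate (1, 5), so the order on the shared machine
  -- need not be examined.
  bound 1F 1F at₀ at₁ = 3F , λ { 0F → ≤-trans (from-yes (1ℚ ≤? 3ℚ)) (time≤completionTime s at₀)
                               ; 1F → time≤completionTime s at₁ }

-- The index `k` is chosen before `p`: one profile bounds both norms at once, which lets a finite
-- check of the profiles settle the simultaneous statement.
norm≥profile : ∀ (s : Solution gapInstance) →
               ∃ λ k → ∀ p → norm p (profile k) ≤ norm p (Solution.completionTime s)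
norm≥profile s with completionTime≥profile s
... | k , profile≤ = k , λ p → norm-mono p (profile k) (Solution.completionTime s)
                                 (λ j → ∣-∣-mono (profile-nonneg k j) (profile≤ j))
  where
  profile-nonneg : ∀ k j → 0ℚ ≤ profile k j
  profile-nonneg = from-yes (all? λ k → all? λ j → 0ℚ ≤? profile k j)

opt≤profile : ∀ p k → opt p ≤ norm p (profile k)
opt≤profile one      = from-yes (all? λ k → 5ℚ ≤? norm one (profile k))
opt≤profile infinity = from-yes (all? λ k → 3ℚ ≤? norm infinity (profile k))

opt-isMinNorm : ∀ p → IsMinNorm gapInstance p (opt p)
opt-isMinNorm p = attained p , λ s → let k , profile≤ = norm≥profile s in
                                     ≤-trans (opt≤profile p k) (profile≤ p)
  where
  attained : ∀ p → ∃ λ s → norm p (Solution.completionTime s) ≡ opt p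
  -- The completion times are (1, 4) for `one` and (3, 3) for `infinity`; both norms are found by
  -- computation.
  attained one      = scheduleByIndex (0F ∷ 0F ∷ []) , refl
  attained infinity = scheduleByIndex (1F ∷ 0F ∷ []) , refl

-- The thresholds are 5.65 and 3.39. The profiles have sums 5, 7, 6, 6 and maxima 4, 4, 3, 5, so
-- only the first misses the sum threshold, and its maximum 4 exceeds 3.39.
profile-gap : ∀ k → (+ 113 / 100) * opt one ≤ norm one (profile k) ⊎
                    (+ 113 / 100) * opt infinity ≤ norm infinity (profile k)
profile-gap = from-yes (all? λ k →
  ((+ 113 / 100) * 5ℚ ≤? norm one (profile k)) ⊎-dec
  ((+ 113 / 100) * 3ℚ ≤? norm infinity (profile k)))

mainTheorem8 : ∃ λ (I : Instance) →
    ∃ λ (opt : Exponent → ℚ) →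
    (∀ p → IsMinNorm I p (opt p)) ×
    (∀ (s : Solution I) → ∃ λ (p : Exponent) →
    norm p (Solution.completionTime s) ≥ (+ 113 / 100) * opt p)
mainTheorem8 = gapInstance , opt , opt-isMinNorm , simultaneous
  where
  simultaneous : ∀ s → ∃ λ p → norm p (Solution.completionTime s) ≥ (+ 113 / 100) * opt p
  simultaneous s with norm≥profile s
  ... | k , profile≤ with profile-gap k
  ...   | inj₁ gap = one      , ≤-trans gap (profile≤ one)
  ...   | inj₂ gap = infinity , ≤-trans gap (profile≤ infinity)
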